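{- The Petersen graph is total threshold colorable.
   Context: All graphs are finite, simple and undirected. A near-far-labeling of a graph $G$ is a pair $(N,F)$ with $N \subseteq E(G)$ and $F = E(G)\setminus N$. For integers $r \geq t$, an $(r,t)$-threshold-coloring of $G$ with respect to $(N,F)$ is a map $c: V(G) \to \{0,\ldots,r-1\}$ with $|c(u)-c(v)| \leq t$ for every $uv \in N$ and $|c(u)-c(v)| > t$ for every $uv \in F$. $G$ is total threshold colorable if there exist integers $r \geq t$ such that $G$ has an $(r,t)$-threshold-coloring with respect to every near-far-labeling. -}

module Defs where

open import Data.Nat using (ℕ; _≤_; _>_; ∣_-_∣; suc)
open import Data.Nat.Properties using ()
open import Data.Fin using (Fin; toℕ)
open import Data.Fin.Patterns
open import Data.Bool using (Bool; true; false; T; not; _∧_; _∨_)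
open import Data.Bool.Properties using (∨-comm)
open import Data.Product using (Σ; ∃; _×_; _,_; proj₁; proj₂)
open import Data.Sum using (_⊎_)
open import Data.List using (List; []; _∷_)
open import Data.Bool.ListAction using (any)
open import Data.Fin using (_≟_)
open import Relation.Nullary.Decidable using (⌊_⌋)
open import Relation.Binary.PropositionalEquality using (_≡_; refl; cong₂)

record Graph : Set where
  field
    n     : ℕ
    adj   : Fin n → Fin n → Bool
    sym   : ∀ u v → adj u v ≡ adj v u
    irrefl : ∀ v → adj v v ≡ false

open Graph public

-- A near-far labeling (N, F): N ⊆ E(G) is given by its characteristic
-- function (only its values on edges matter; symmetric since edges are
-- unordered); F = E(G) \ N.
record NearFarLabeling (G : Graph) : Set where
  field
    near    : Fin (n G) → Fin (n G) → Bool
    nearSym : ∀ u v → near u v ≡ near v u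

open NearFarLabeling public

InN : {G : Graph} → NearFarLabeling G → Fin (n G) → Fin (n G) → Set
InN {G} L u v = T (adj G u v) × T (near L u v)

InF : {G : Graph} → NearFarLabeling G → Fin (n G) → Fin (n G) → Set
InF {G} L u v = T (adj G u v) × T (not (near L u v))

ThresholdColoring : (G : Graph) → (r t : ℕ) → NearFarLabeling G → Set
ThresholdColoring G r t L =
  Σ (Fin (n G) → Fin r) λ c →
    (∀ u v → InN L u v → ∣ toℕ (c u) - toℕ (c v) ∣ ≤ t) ×
    (∀ u v → InF L u v → ∣ toℕ (c u) - toℕ (c v) ∣ > t)

TotalThresholdColorable : Graph → Set
TotalThresholdColorable G =
  Σ ℕ λ r → Σ ℕ λ t → (t ≤ r) ×
    ((L : NearFarLabeling G) → ThresholdColoring G r t L)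

-- The Petersen graph: outer 5-cycle 0-1-2-3-4, spokes i ~ i+5,
-- inner pentagram 5-7-9-6-8-5.
petersenEdges : List (Fin 10 × Fin 10)
petersenEdges =
  (0F , 1F) ∷ (1F , 2F) ∷ (2F , 3F) ∷ (3F , 4F) ∷ (4F , 0F) ∷
  (0F , 5F) ∷ (1F , 6F) ∷ (2F , 7F) ∷ (3F , 8F) ∷ (4F , 9F) ∷
  (5F , 7F) ∷ (7F , 9F) ∷ (9F , 6F) ∷ (6F , 8F) ∷ (8F , 5F) ∷ []

edgeTest : ∀ {m} → Fin m → Fin m → Fin m × Fin m → Bool
edgeTest u v (a , b) = (⌊ a ≟ u ⌋ ∧ ⌊ b ≟ v ⌋) ∨ (⌊ a ≟ v ⌋ ∧ ⌊ b ≟ u ⌋)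

adjFromList : ∀ {m} → List (Fin m × Fin m) → Fin m → Fin m → Bool
adjFromList es u v = any (edgeTest u v) es

adjFromList-sym : ∀ {m} (es : List (Fin m × Fin m)) u v →
                  adjFromList es u v ≡ adjFromList es v u
adjFromList-sym [] u v = refl
adjFromList-sym (e ∷ es) u v =
  cong₂ _∨_ (∨-comm (⌊ proj₁ e ≟ u ⌋ ∧ ⌊ proj₂ e ≟ v ⌋) (⌊ proj₁ e ≟ v ⌋ ∧ ⌊ proj₂ e ≟ u ⌋))
            (adjFromList-sym es u v)

petersenAdj : Fin 10 → Fin 10 → Bool
petersenAdj = adjFromList petersenEdges

Petersen : Graph
Petersen = record
  { n = 10
  ; adj = petersenAdj
  ; sym = adjFromList-sym petersenEdges
  ; irrefl = irrP
  }
  where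
  irrP : ∀ v → petersenAdj v v ≡ false
  irrP 0F = refl
  irrP 1F = refl
  irrP 2F = refl
  irrP 3F = refl
  irrP 4F = refl
  irrP 5F = refl
  irrP 6F = refl
  irrP 7F = refl
  irrP 8F = refl
  irrP 9F = refl

{-# OPTIONS --safe #-}

-- The vertices 0, 2, 8, 9 are independent, and the other six form a perfect
-- matching 1–6, 5–7, 4–3; each edge of the matching joins the common neighbours
-- of two complementary pairs in {0, 2, 8, 9}. So once 0, 2, 8, 9 are coloured,
-- the three matching edges are coloured independently of one another, each
-- subject to the labels of only five edges. With r = 8 and t = 2, twenty
-- colourings of 0, 2, 8, 9 suffice: for all 32³ labels, one of them extends
-- to all three matching edges.

module Submission where

open import Defs
open import Data.Bool using (Bool; true; false; T; not; _∧_; _∨_)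
open import Data.Bool.Properties using (T-∧; T-∨)
open import Data.Fin using (Fin; zero; suc; toℕ; _≟_)
open import Data.Fin.Patterns
open import Data.Fin.Properties using (any?)
open import Data.List using (List; []; _∷_)
open import Data.List.Membership.Propositional using (_∈_)
open import Data.List.Relation.Unary.All as All using (All; []; _∷_)
open import Data.List.Relation.Unary.Any using (here; there)
open import Data.Nat using (ℕ; zero; suc; _≤_; _>_; _≤?_; _>?_; ∣_-_∣)
open import Data.Nat.Properties using (∣-∣-comm)
open import Data.Product using (∃; _×_; _,_; proj₁; proj₂)
open import Data.Sum as Sum using (_⊎_; inj₁; inj₂)
open import Data.Unit using (tt)
open import Data.Vec using (Vec; []; _∷_; lookup; map; zipWith)
open import Data.Vec.Properties using (lookup-map; lookup-zipWith)
open import Function using (Equivalence)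
open import Relation.Binary.PropositionalEquality using (_≡_; subst; cong₂) renaming (sym to ≡-sym)
open import Relation.Nullary using (Dec)
open import Relation.Nullary.Decidable using (⌊_⌋; toWitness; _×-dec_)

open Equivalence using (to)

private variable
  A : Set
  k m r : ℕ

-- Indexing one relation by the label lets a single decision procedure serve both near and far
-- edges.
Agrees : ℕ → Bool → Fin r → Fin r → Set
Agrees t true  x y = ∣ toℕ x - toℕ y ∣ ≤ t
Agrees t false x y = ∣ toℕ x - toℕ y ∣ > t

agrees? : ∀ t b (x y : Fin r) → Dec (Agrees t b x y)
agrees? t true  x y = ∣ toℕ x - toℕ y ∣ ≤? t
agrees? t false x y = ∣ toℕ x - toℕ y ∣ >? t

Agrees-sym : ∀ t b (x y : Fin r) → Agrees t b x y → Agrees t b y x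
Agrees-sym t true  x y = subst (_≤ t) (∣-∣-comm (toℕ x) (toℕ y))
Agrees-sym t false x y = subst (_> t) (∣-∣-comm (toℕ x) (toℕ y))

Agrees-near : ∀ t b (x y : Fin r) → T b → Agrees t b x y → ∣ toℕ x - toℕ y ∣ ≤ t
Agrees-near t true x y _ p = p

Agrees-far : ∀ t b (x y : Fin r) → T (not b) → Agrees t b x y → ∣ toℕ x - toℕ y ∣ > t
Agrees-far t false x y _ p = p

≟-pair-sound : ∀ (u v a b : Fin m) → T (⌊ a ≟ u ⌋ ∧ ⌊ b ≟ v ⌋) → (u , v) ≡ (a , b)
≟-pair-sound u v a b h with p , q ← to (T-∧ {⌊ a ≟ u ⌋}) h =
  cong₂ _,_ (≡-sym (toWitness p)) (≡-sym (toWitness q))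

adjFromList-sound : ∀ (es : List (Fin m × Fin m)) u v →
                    T (adjFromList es u v) → (u , v) ∈ es ⊎ (v , u) ∈ es
adjFromList-sound ((a , b) ∷ es) u v h with to T-∨ h
... | inj₂ h′ = Sum.map there there (adjFromList-sound es u v h′)
... | inj₁ h′ with to T-∨ h′
...   | inj₁ p = inj₁ (here (≟-pair-sound u v a b p))
...   | inj₂ p = inj₂ (here (≟-pair-sound v u a b p))

-- Distance and `near` are both symmetric, so it is enough to check each edge in the one orientation
-- in which `petersenEdges` lists it.
petersenColoring : ∀ t (L : NearFarLabeling Petersen) (c : Fin 10 → Fin r) →
                   All (λ (u , v) → Agrees t (near L u v) (c u) (c v)) petersenEdges →
                   ThresholdColoring Petersen r t L
petersenColoring t L c ok =
  c , (λ u v (uv , ν) → Agrees-near t _ (c u) (c v) ν (agrees u v uv))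
    , (λ u v (uv , φ) → Agrees-far t _ (c u) (c v) φ (agrees u v uv))
  where
  agrees : ∀ u v → T (petersenAdj u v) → Agrees t (near L u v) (c u) (c v)
  agrees u v uv with adjFromList-sound petersenEdges u v uv
  ... | inj₁ p = All.lookup ok p
  ... | inj₂ p = subst (λ b → Agrees t b (c u) (c v)) (nearSym L v u)
                   (Agrees-sym t _ (c v) (c u) (All.lookup ok p))

Labels : Set
Labels = Vec Bool 5

-- The path a – x – b and the path c – y – d, joined by the edge xy.
Extends : ∀ {r} → ℕ → (a b c d : Fin r) → Labels → Set
Extends t a b c d (xa ∷ xb ∷ yc ∷ yd ∷ xy ∷ []) =
  ∃ λ x → (Agrees t xa x a × Agrees t xb x b) ×
  ∃ λ y → (Agrees t yc y c × Agrees t yd y d) × Agrees t xy x y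

extends? : ∀ t (a b c d : Fin r) ℓ → Dec (Extends t a b c d ℓ)
extends? t a b c d (xa ∷ xb ∷ yc ∷ yd ∷ xy ∷ []) =
  -- The tests on `x` precede the search for `y`, so an unsuitable `x` starts no inner search.
  any? λ x → (agrees? t xa x a ×-dec agrees? t xb x b) ×-dec
  any? λ y → (agrees? t yc y c ×-dec agrees? t yd y d) ×-dec agrees? t xy x y

-- Functions on Vec Bool k stored as complete binary trees, so that evaluation
-- computes each value only once.
data Table (A : Set) : ℕ → Set where
  leaf : A → Table A zero
  node : Table A k → Table A k → Table A (suc k)

tabulate : (Vec Bool k → A) → Table A k
tabulate {zero}  f = leaf (f [])
tabulate {suc k} f = node (tabulate λ ℓ → f (true ∷ ℓ)) (tabulate λ ℓ → f (false ∷ ℓ))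

everywhere : (A → Bool) → Table A k → Bool
everywhere p (leaf x)   = p x
everywhere p (node s t) = everywhere p s ∧ everywhere p t

everywhere-sound : ∀ (p : A → Bool) (f : Vec Bool k → A) →
                   T (everywhere p (tabulate f)) → ∀ ℓ → T (p (f ℓ))
everywhere-sound p f h []          = h
everywhere-sound p f h (true ∷ ℓ)  = everywhere-sound p _ (proj₁ (to T-∧ h)) ℓ
everywhere-sound p f h (false ∷ ℓ) = everywhere-sound p _ (proj₂ (to T-∧ h)) ℓ

-- Boolean vectors act as characteristic vectors of index sets, later sets of frames; `meet` tests
-- for a nonempty intersection.
meet : Vec Bool m → Vec Bool m → Bool
meet []       []       = false
meet (x ∷ xs) (y ∷ ys) = (x ∧ y) ∨ meet xs ys

meet-sound : ∀ (xs ys : Vec Bool m) → T (meet xs ys) →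
             ∃ λ i → T (lookup xs i) × T (lookup ys i)
meet-sound []       []       ()
meet-sound (x ∷ xs) (y ∷ ys) h with to T-∨ h
... | inj₁ p = zero , to T-∧ p
... | inj₂ p with i , q ← meet-sound xs ys p = suc i , q

-- A separate function, because a let-bound intersection would be recomputed for
-- every entry of W.
meetAll₃ : Table (Vec Bool m) k → Vec Bool m → Bool
meetAll₃ W u = everywhere (meet u) W

meetAll₂ : Table (Vec Bool m) k → Table (Vec Bool m) k → Vec Bool m → Bool
meetAll₂ V W u = everywhere (λ v → meetAll₃ W (zipWith _∧_ u v)) V

meetAll : Table (Vec Bool m) k → Table (Vec Bool m) k → Table (Vec Bool m) k → Bool
meetAll U V W = everywhere (meetAll₂ V W) U

meetAll-sound : ∀ (f g h : Vec Bool k → Vec Bool m) →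
                T (meetAll (tabulate f) (tabulate g) (tabulate h)) → ∀ ℓ₁ ℓ₂ ℓ₃ →
                ∃ λ i → T (lookup (f ℓ₁) i) × T (lookup (g ℓ₂) i) × T (lookup (h ℓ₃) i)
meetAll-sound f g h ok ℓ₁ ℓ₂ ℓ₃
  with ok₁ ← everywhere-sound (meetAll₂ (tabulate g) (tabulate h)) f ok ℓ₁
  with ok₂ ← everywhere-sound (λ v → meetAll₃ (tabulate h) (zipWith _∧_ (f ℓ₁) v)) g ok₁ ℓ₂
  with ok₃ ← everywhere-sound (meet (zipWith _∧_ (f ℓ₁) (g ℓ₂))) h ok₂ ℓ₃
  with i , p , q ← meet-sound (zipWith _∧_ (f ℓ₁) (g ℓ₂)) (h ℓ₃) ok₃
  with p₁ , p₂ ← to T-∧ (subst T (lookup-zipWith _∧_ i (f ℓ₁) (g ℓ₂)) p)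
  = i , p₁ , p₂ , q

Frame : Set
Frame = Vec (Fin 8) 4

-- A pairing lists the positions of a, b, c, d of Extends in a frame.
Pairing : Set
Pairing = Fin 4 × Fin 4 × Fin 4 × Fin 4

ExtendsFrame : Pairing → Frame → Labels → Set
ExtendsFrame (i , j , k , l) f =
  Extends 2 (lookup f i) (lookup f j) (lookup f k) (lookup f l)

extendsFrame? : ∀ π f ℓ → Dec (ExtendsFrame π f ℓ)
extendsFrame? (i , j , k , l) f =
  extends? 2 (lookup f i) (lookup f j) (lookup f k) (lookup f l)

goodFrames : Pairing → Vec Frame m → Labels → Vec Bool m
goodFrames π fs ℓ = map (λ f → ⌊ extendsFrame? π f ℓ ⌋) fs

goodFrames-sound : ∀ π (fs : Vec Frame m) ℓ i → T (lookup (goodFrames π fs ℓ) i) →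
                   ExtendsFrame π (lookup fs i) ℓ
goodFrames-sound π fs ℓ i h =
  toWitness {a? = extendsFrame? π (lookup fs i) ℓ}
    (subst T (lookup-map i (λ f → ⌊ extendsFrame? π f ℓ ⌋) fs) h)

-- The three splittings of the vertices 0, 2, 8, 9 into two pairs; they belong to the matching edges
-- 1-6, 5-7 and 4-3 in turn.
π₁ π₂ π₃ : Pairing
π₁ = 0F , 1F , 2F , 3F
π₂ = 0F , 2F , 1F , 3F
π₃ = 0F , 3F , 1F , 2F

-- Extension is tested for only 3 · 32 label vectors per frame; the 32³ triples merely intersect the
-- resulting sets of frames. This keeps the check feasible during type checking.
suffices : Vec Frame m → Bool
suffices fs = meetAll (tabulate (goodFrames π₁ fs)) (tabulate (goodFrames π₂ fs))
                      (tabulate (goodFrames π₃ fs))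

suffices-sound : ∀ (fs : Vec Frame m) → T (suffices fs) → ∀ ℓ₁ ℓ₂ ℓ₃ → ∃ λ f →
                 ExtendsFrame π₁ f ℓ₁ × ExtendsFrame π₂ f ℓ₂ × ExtendsFrame π₃ f ℓ₃
suffices-sound fs ok ℓ₁ ℓ₂ ℓ₃ =
  let i , p , q , s = meetAll-sound (goodFrames π₁ fs) (goodFrames π₂ fs)
                        (goodFrames π₃ fs) ok ℓ₁ ℓ₂ ℓ₃
  in lookup fs i , goodFrames-sound π₁ fs ℓ₁ i p , goodFrames-sound π₂ fs ℓ₂ i q
     , goodFrames-sound π₃ fs ℓ₃ i s

-- Found by a greedy computer search; the entries of a frame are the colours of
-- the vertices 0, 2, 8, 9.
frames : Vec Frame 20
frames =
  (0F ∷ 3F ∷ 3F ∷ 4F ∷ []) ∷ (3F ∷ 3F ∷ 7F ∷ 4F ∷ []) ∷ (3F ∷ 0F ∷ 3F ∷ 4F ∷ []) ∷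
  (0F ∷ 4F ∷ 7F ∷ 3F ∷ []) ∷ (3F ∷ 7F ∷ 0F ∷ 4F ∷ []) ∷ (1F ∷ 4F ∷ 3F ∷ 0F ∷ []) ∷
  (1F ∷ 7F ∷ 3F ∷ 4F ∷ []) ∷ (1F ∷ 3F ∷ 5F ∷ 4F ∷ []) ∷ (3F ∷ 3F ∷ 0F ∷ 4F ∷ []) ∷
  (3F ∷ 2F ∷ 6F ∷ 4F ∷ []) ∷ (3F ∷ 6F ∷ 4F ∷ 7F ∷ []) ∷ (3F ∷ 0F ∷ 4F ∷ 4F ∷ []) ∷
  (3F ∷ 4F ∷ 2F ∷ 0F ∷ []) ∷ (0F ∷ 3F ∷ 4F ∷ 2F ∷ []) ∷ (0F ∷ 1F ∷ 2F ∷ 6F ∷ []) ∷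
  (0F ∷ 5F ∷ 7F ∷ 6F ∷ []) ∷ (2F ∷ 3F ∷ 0F ∷ 4F ∷ []) ∷ (3F ∷ 5F ∷ 4F ∷ 0F ∷ []) ∷
  (3F ∷ 4F ∷ 0F ∷ 2F ∷ []) ∷ (0F ∷ 0F ∷ 1F ∷ 4F ∷ []) ∷ []

-- Abstract, so that the large computation is never unfolded again.
abstract
  extensible : ∀ ℓ₁ ℓ₂ ℓ₃ → ∃ λ f →
               ExtendsFrame π₁ f ℓ₁ × ExtendsFrame π₂ f ℓ₂ × ExtendsFrame π₃ f ℓ₃
  extensible = suffices-sound frames tt

theorem3 : TotalThresholdColorable Petersen
theorem3 = 8 , 2 , toWitness {a? = 2 ≤? 8} tt , color
  where
  color : (L : NearFarLabeling Petersen) → ThresholdColoring Petersen 8 2 L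
  color L
    with a ∷ b ∷ c ∷ d ∷ []
       , (x₁ , (x₁a , x₁b) , y₁ , (y₁c , y₁d) , x₁y₁)
       , (x₂ , (x₂a , x₂c) , y₂ , (y₂b , y₂d) , x₂y₂)
       , (x₃ , (x₃a , x₃d) , y₃ , (y₃b , y₃c) , x₃y₃)
       ← extensible
           -- Each row follows the order in `Extends`: two edges at x, two edges at y, then the
           -- matching edge xy.
           (near L 1F 0F ∷ near L 1F 2F ∷ near L 6F 8F ∷ near L 6F 9F ∷ near L 1F 6F ∷ [])
           (near L 5F 0F ∷ near L 5F 8F ∷ near L 7F 2F ∷ near L 7F 9F ∷ near L 5F 7F ∷ [])
           (near L 4F 0F ∷ near L 4F 9F ∷ near L 3F 2F ∷ near L 3F 8F ∷ near L 4F 3F ∷ [])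
    = petersenColoring 2 L (lookup κ)
        -- In the order of `petersenEdges`; `flip` reverses the edges that are listed there in the
        -- direction opposite to the rows above.
        (flip 1F 0F x₁a ∷ x₁b ∷ flip 3F 2F y₃b ∷ flip 4F 3F x₃y₃ ∷ x₃a ∷
         flip 5F 0F x₂a ∷ x₁y₁ ∷ flip 7F 2F y₂b ∷ y₃c ∷ x₃d ∷
         x₂y₂ ∷ y₂d ∷ flip 6F 9F y₁d ∷ y₁c ∷ flip 5F 8F x₂c ∷ [])
    where
    κ : Vec (Fin 8) 10
    κ = a ∷ x₁ ∷ b ∷ y₃ ∷ x₃ ∷ x₂ ∷ y₁ ∷ y₂ ∷ c ∷ d ∷ []

    flip : ∀ u v → Agrees 2 (near L u v) (lookup κ u) (lookup κ v) →
           Agrees 2 (near L v u) (lookup κ v) (lookup κ u)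
    flip u v p = subst (λ β → Agrees 2 β (lookup κ v) (lookup κ u)) (nearSym L u v)
                   (Agrees-sym 2 (near L u v) (lookup κ u) (lookup κ v) p)
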